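{- Let $n$ be a natural number and $s$ a negative integer with $n+s>0$, and put $m=\frac{(-s)(n-1)}{n+s}$. Suppose there exists a divisible design graph $\Delta$ with parameters $(V,K,\lambda_1,\lambda_2;m,n)$, where $V=\frac{n(-s)(n-1)}{n+s}$, $K=(-s)(n-1)$, $\lambda_1=(-s)(n+s-1)$, $\lambda_2=\frac{(-s)(n-1)(n+s)}{n}$, with canonical classes $P_1,\dots,P_m$. Let $\mathcal{D}=(\mathcal{P},\mathcal{B})$ be a symmetric $2$-design with parameters $(m,-s,\frac{(-s)(n+s)}{n})$, with $\mathcal{P}$ disjoint from the vertex set of $\Delta$, and let $\phi$ be any bijection from $\{P_1,\dots,P_m\}$ to $\mathcal{B}$. Define the graph $\Gamma$ with vertex set $V(\Delta)\cup\mathcal{P}$ in which: two vertices of $\Delta$ are adjacent iff they are adjacent in $\Delta$; no two points of $\mathcal{P}$ are adjacent; a vertex $x\in P_i$ is adjacent to $y\in\mathcal{P}$ iff $y\in\phi(P_i)$. Then $\Gamma$ is a strongly regular graph with parameters $v=m(n+1)$, $k=(-s)n$, $\lambda=\mu=(-s)(n+s)$.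
   Context: A $K$-regular graph on $V$ vertices, neither complete nor edgeless, is a divisible design graph with parameters $(V,K,\lambda_1,\lambda_2;m,n)$ if its vertex set can be partitioned into $m$ classes (canonical classes) of size $n$ such that any two distinct vertices in the same class have exactly $\lambda_1$ common neighbours and any two vertices in different classes have exactly $\lambda_2$ common neighbours. A symmetric $2$-design with parameters $(m,\kappa,\ell)$ is a pair $(\mathcal{P},\mathcal{B})$ where $\mathcal{P}$ is a set of $m$ points and $\mathcal{B}$ a set of $m$ subsets (blocks) of $\mathcal{P}$, each of size $\kappa$, such that every two distinct points lie in exactly $\ell$ common blocks (equivalently, any two distinct blocks meet in exactly $\ell$ points). A strongly regular graph with parameters $(v,k,\lambda,\mu)$ is a $k$-regular graph on $v$ vertices in which adjacent vertices have $\lambda$ and distinct non-adjacent vertices have $\mu$ common neighbours. -}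

module Defs where

open import Data.Bool.Base using (Bool)
open import Data.Nat.Base using (ℕ; _+_)
open import Data.Fin.Base using (Fin; splitAt)
open import Data.Fin.Properties using (_≟_)
open import Data.Fin.Subset using (Subset; _∈_; _∩_; ∣_∣)
open import Data.Fin.Subset.Properties using (_∈?_)
open import Data.Vec.Base using (tabulate)
open import Data.Sum.Base using (_⊎_; inj₁; inj₂)
open import Data.Empty using (⊥)
open import Function.Base using (_on_)
open import Function.Bundles using (_⤖_; module Bijection)
open import Function.Definitions using (Injective)
open import Level using (0ℓ)
open import Relation.Binary.Core using (Rel)
open import Relation.Binary.Definitions using (Decidable; Symmetric; Irreflexive)
open import Relation.Binary.PropositionalEquality using (_≡_; _≢_; refl)
open import Relation.Nullary using (¬_; Dec; no; does)
open import Relation.Unary using (Pred) renaming (Decidable to Decidable₁)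

⟦_⟧ : ∀ {v} {P : Pred (Fin v) 0ℓ} → Decidable₁ P → Subset v
⟦ P? ⟧ = tabulate λ x → does (P? x)

record Graph (v : ℕ) : Set₁ where
  infix 4 _~_ _~?_
  field
    _~_      : Rel (Fin v) 0ℓ
    _~?_     : Decidable _~_
    ~-sym    : Symmetric _~_
    ~-irrefl : Irreflexive _≡_ _~_

  N : Fin v → Subset v
  N x = ⟦ x ~?_ ⟧

  degree : Fin v → ℕ
  degree x = ∣ N x ∣

  commonNeighbours : Fin v → Fin v → ℕ
  commonNeighbours x y = ∣ N x ∩ N y ∣

  Regular : ℕ → Set
  Regular k = ∀ x → degree x ≡ k

  Complete : Set
  Complete = ∀ x y → x ≢ y → x ~ y

  Edgeless : Set
  Edgeless = ∀ x y → ¬ x ~ y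

record IsStronglyRegular {u} (G : Graph u) (v k lam mu : ℕ) : Set where
  open Graph G
  field
    order       : u ≡ v
    regular     : Regular k
    adjacent    : ∀ x y → x ~ y → commonNeighbours x y ≡ lam
    nonadjacent : ∀ x y → x ≢ y → ¬ x ~ y → commonNeighbours x y ≡ mu

-- The partition into canonical classes P₁, …, Pₘ is recorded by the map
-- sending a vertex to the index of its class.
record DivisibleDesignGraph (V K λ₁ λ₂ m n : ℕ) : Set₁ where
  field
    graph : Graph V
  open Graph graph public
  field
    regular     : Regular K
    notComplete : ¬ Complete
    notEdgeless : ¬ Edgeless
    class       : Fin V → Fin m

  P : Fin m → Subset V
  P i = ⟦ (λ x → class x ≟ i) ⟧

  field
    classSize      : ∀ i → ∣ P i ∣ ≡ n
    sameClass      : ∀ x y → x ≢ y → class x ≡ class y → commonNeighbours x y ≡ λ₁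
    differentClass : ∀ x y → class x ≢ class y → commonNeighbours x y ≡ λ₂

-- The set of m blocks is given by an enumeration without repetition.
record SymmetricDesign (m κ ℓ : ℕ) : Set where
  field
    block           : Fin m → Subset m
    block-injective : Injective _≡_ _≡_ block

  blocksThrough : Fin m → Subset m
  blocksThrough p = ⟦ (λ b → p ∈? block b) ⟧

  field
    blockSize : ∀ b → ∣ block b ∣ ≡ κ
    balanced  : ∀ p q → p ≢ q → ∣ blocksThrough p ∩ blocksThrough q ∣ ≡ ℓ

-- φ is a bijection from (indices of) canonical classes to (indices of) blocks.
module _ {V K λ₁ λ₂ m n κ ℓ : ℕ} (Δ : DivisibleDesignGraph V K λ₁ λ₂ m n)
         (𝒟 : SymmetricDesign m κ ℓ) (φ : Fin m ⤖ Fin m) where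

  private
    module Δ = DivisibleDesignGraph Δ
    module 𝒟 = SymmetricDesign 𝒟

  φ[class_] : Fin V → Subset m
  φ[class x ] = 𝒟.block (Bijection.to φ (Δ.class x))

  Adjacent : Rel (Fin V ⊎ Fin m) 0ℓ
  Adjacent (inj₁ x) (inj₁ y) = x Δ.~ y
  Adjacent (inj₁ x) (inj₂ p) = p ∈ φ[class x ]
  Adjacent (inj₂ p) (inj₁ x) = p ∈ φ[class x ]
  Adjacent (inj₂ p) (inj₂ q) = ⊥

  adjacent? : Decidable Adjacent
  adjacent? (inj₁ x) (inj₁ y) = x Δ.~? y
  adjacent? (inj₁ x) (inj₂ p) = p ∈? φ[class x ]
  adjacent? (inj₂ p) (inj₁ x) = p ∈? φ[class x ]
  adjacent? (inj₂ p) (inj₂ q) = no λ ()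

  adjacent-sym : Symmetric Adjacent
  adjacent-sym {inj₁ x} {inj₁ y} x~y = Δ.~-sym x~y
  adjacent-sym {inj₁ x} {inj₂ p} p∈  = p∈
  adjacent-sym {inj₂ p} {inj₁ x} p∈  = p∈

  adjacent-irrefl : Irreflexive _≡_ Adjacent
  adjacent-irrefl {inj₁ x} refl x~x = Δ.~-irrefl refl x~x

  -- Fin (V + m) is the disjoint union of Fin V (vertices of Δ) and Fin m (points of 𝒟).
  Γ : Graph (V + m)
  Γ = record
    { _~_      = Adjacent on splitAt V
    ; _~?_     = λ x y → adjacent? (splitAt V x) (splitAt V y)
    ; ~-sym    = λ {x} {y} → adjacent-sym {splitAt V x} {splitAt V y}
    ; ~-irrefl = λ { {x} refl → adjacent-irrefl {splitAt V x} refl }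
    }

{-# OPTIONS --safe #-}
module Submission where

open import Data.Nat.Base as ℕ using (ℕ; zero; suc; z≤n)
open import Data.Integer.Base
  using (ℤ; +_; -[1+_]; -_; _+_; _-_; _*_; _≤_; _<_; 0ℤ; 1ℤ; +≤+; NonZero; ≢-nonZero; >-nonZero; nonNegative)
open import Data.Integer.Properties
  using (+-*-semiring; *-identityˡ; *-identityʳ; *-zeroʳ; *-comm; *-assoc; *-distribˡ-+; *-distribʳ-+;
         +-identityˡ; +-identityʳ; +-assoc; +-injective; pos-+; pos-*; *-cancelˡ-≡; *-cancelʳ-≡;
         i*j≡0⇒i≡0∨j≡0; i-j≡0⇒i≡j; ≤-refl; ≤-antisym; ≤-trans; ≤-reflexive; +-mono-≤;
         +-mono-<; neg-mono-<; i≤i+j; <⇒≢)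
open import Data.Integer.Tactic.RingSolver using (solve-∀)
open import Algebra.Properties.Semiring.Sum +-*-semiring
  using (sum; sum-cong-≗; sum-permute; ∑-distrib-+; ∑-comm; *-distribˡ-sum; *-distribʳ-sum; sum-syntax)
open import Data.Bool.Base using (Bool; true; false)
open import Data.Fin.Base using (Fin; zero; suc; splitAt; join)
open import Data.Fin.Properties using (_≟_; join-splitAt)
open import Data.Fin.Subset using (Subset; _∩_; ∣_∣; inside; outside)
open import Data.Fin.Subset.Properties using (_∈?_)
open import Data.Vec.Base using (tabulate; []; _∷_)
open import Data.Product.Base using (_×_; _,_; ∃₂)
open import Data.Sum.Base as Sum using (_⊎_; inj₁; inj₂)
open import Function.Base using (_∘_)
open import Function.Bundles using (_⤖_; mk⇔; module Bijection)
open import Function.Properties.Bijection using (⤖⇒↔)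
open import Relation.Nullary using (Dec; yes; no; does; contradiction)
open import Relation.Nullary.Decidable using (dec-true; dec-false; does-⇔)
open import Relation.Binary.PropositionalEquality
  using (_≡_; _≢_; _≗_; refl; sym; trans; cong; cong₂; subst; module ≡-Reasoning)
open import Defs
open ≡-Reasoning

-- Write a = -s and t = n + s, and let A be the adjacency matrix of Δ and S the indicator matrix of
-- "same class", so that A² = (K - λ₁) I + (λ₁ - λ₂) S + λ₂ J. Since λ₁ ≠ λ₂ and A commutes with A²
-- and J, it commutes with S; this gives Σᵢ rᵢ² = K + λ₁ (n - 1) = m t² for the numbers rᵢ of
-- neighbours of a vertex x in the class Pᵢ. As Σᵢ rᵢ = K = m t, the rᵢ have variance zero, so x has
-- exactly t neighbours in every class. The same variance argument shows that two distinct blocks of 𝒟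
-- meet in ℓ points. The common neighbours in Γ are then λ₁ + a (same class), λ₂ + ℓ (different
-- classes), n ℓ (two points) and t a (a vertex and a point), each of which equals a t.

-- Inner products of integer vectors.

private variable
  k l : ℕ

infix 8 _∙_

𝟏 : Fin k → ℤ
𝟏 _ = 1ℤ

opaque
  -- Opaque: outside the blocks that unfold it, `u ∙ v` is a rigid symbol, handled only through its
  -- algebraic laws.
  _∙_ : (Fin k → ℤ) → (Fin k → ℤ) → ℤ
  u ∙ v = sum λ i → u i * v i

  ∙-congˡ : ∀ (u : Fin k → ℤ) {v w : Fin k → ℤ} → v ≗ w → u ∙ v ≡ u ∙ w
  ∙-congˡ u v≗w = sum-cong-≗ λ i → cong (u i *_) (v≗w i)

  ∙-comm : ∀ (u v : Fin k → ℤ) → u ∙ v ≡ v ∙ u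
  ∙-comm u v = sum-cong-≗ λ i → *-comm (u i) (v i)

  -- Holds by exchanging the two summations. With `u` and `v` indicator vectors and `M` a 0/1 matrix
  -- it is a double count.
  ∙-assoc : ∀ (u : Fin k → ℤ) (M : Fin k → Fin l → ℤ) (v : Fin l → ℤ) →
            u ∙ (λ i → M i ∙ v) ≡ (λ j → u ∙ λ i → M i j) ∙ v
  ∙-assoc {k} {l} u M v = begin
    (∑[ i < k ] (u i * ∑[ j < l ] (M i j * v j)))
      ≡⟨ sum-cong-≗ (λ i → *-distribˡ-sum (u i) (λ j → M i j * v j)) ⟩
    (∑[ i < k ] ∑[ j < l ] (u i * (M i j * v j)))
      ≡⟨ ∑-comm (λ i j → u i * (M i j * v j)) ⟩
    (∑[ j < l ] ∑[ i < k ] (u i * (M i j * v j)))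
      ≡⟨ sum-cong-≗ (λ j → sum-cong-≗ λ i → *-assoc (u i) (M i j) (v j)) ⟨
    (∑[ j < l ] ∑[ i < k ] (u i * M i j * v j))
      ≡⟨ sum-cong-≗ (λ j → *-distribʳ-sum (v j) (λ i → u i * M i j)) ⟨
    (∑[ j < l ] (∑[ i < k ] (u i * M i j) * v j)) ∎

  ∙-scale : ∀ (u f : Fin k → ℤ) c → u ∙ (λ i → c * f i) ≡ c * (u ∙ f)
  ∙-scale u f c = begin
    (sum λ i → u i * (c * f i)) ≡⟨ sum-cong-≗ (λ i → swap (u i) c (f i)) ⟩
    (sum λ i → c * (u i * f i)) ≡⟨ *-distribˡ-sum c (λ i → u i * f i) ⟨
    c * (sum λ i → u i * f i)   ∎
    where
    swap : ∀ u c f → u * (c * f) ≡ c * (u * f)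
    swap = solve-∀

  ∙-+ : ∀ (u f g : Fin k → ℤ) → u ∙ (λ i → f i + g i) ≡ u ∙ f + u ∙ g
  ∙-+ u f g = begin
    (sum λ i → u i * (f i + g i))                   ≡⟨ sum-cong-≗ (λ i → *-distribˡ-+ (u i) (f i) (g i)) ⟩
    (sum λ i → u i * f i + u i * g i)               ≡⟨ ∑-distrib-+ (λ i → u i * f i) (λ i → u i * g i) ⟩
    (sum λ i → u i * f i) + (sum λ i → u i * g i)   ∎

  𝟏∙-* : ∀ (u v : Fin k → ℤ) → 𝟏 ∙ (λ i → u i * v i) ≡ u ∙ v
  𝟏∙-* u v = sum-cong-≗ λ i → *-identityˡ (u i * v i)

  -- Relabelling only reorders the summands. Hence row sums and inner products of rows of an
  -- incidence matrix do not depend on the choice of `φ`.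
  ∙-permute : ∀ (u v : Fin k → ℤ) (φ : Fin k ⤖ Fin k) →
              let open Bijection φ using (to) in (u ∘ to) ∙ (v ∘ to) ≡ u ∙ v
  ∙-permute u v φ = sym (sum-permute (λ i → u i * v i) (⤖⇒↔ φ))

∙-congʳ : ∀ {u w : Fin k → ℤ} (v : Fin k → ℤ) → u ≗ w → u ∙ v ≡ w ∙ v
∙-congʳ {u = u} {w} v u≗w = trans (∙-comm u v) (trans (∙-congˡ v u≗w) (∙-comm v w))

∙-linear : ∀ (u f g : Fin k → ℤ) c d →
           u ∙ (λ i → c * f i + d * g i) ≡ c * (u ∙ f) + d * (u ∙ g)
∙-linear u f g c d = begin
  u ∙ (λ i → c * f i + d * g i)                 ≡⟨ ∙-+ u (λ i → c * f i) (λ i → d * g i) ⟩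
  u ∙ (λ i → c * f i) + u ∙ (λ i → d * g i)     ≡⟨ cong₂ _+_ (∙-scale u f c) (∙-scale u g d) ⟩
  c * (u ∙ f) + d * (u ∙ g)                     ∎

∙-linear₃ : ∀ (u f g h : Fin k → ℤ) c d e →
            u ∙ (λ i → c * f i + d * g i + e * h i) ≡ c * (u ∙ f) + d * (u ∙ g) + e * (u ∙ h)
∙-linear₃ u f g h c d e = begin
  u ∙ (λ i → c * f i + d * g i + e * h i)                 ≡⟨ ∙-+ u (λ i → c * f i + d * g i) (λ i → e * h i) ⟩
  u ∙ (λ i → c * f i + d * g i) + u ∙ (λ i → e * h i)     ≡⟨ cong₂ _+_ (∙-linear u f g c d) (∙-scale u h e) ⟩
  c * (u ∙ f) + d * (u ∙ g) + e * (u ∙ h)                 ∎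

∙-const : ∀ (u : Fin k → ℤ) c → u ∙ (λ _ → c) ≡ c * (u ∙ 𝟏)
∙-const u c = begin
  u ∙ (λ _ → c)        ≡⟨ ∙-congˡ u (λ _ → *-identityʳ c) ⟨
  u ∙ (λ _ → c * 1ℤ)   ≡⟨ ∙-scale u 𝟏 c ⟩
  c * (u ∙ 𝟏)          ∎

-- The squared norm of the row vector u M is the quadratic form of the Gram matrix M Mᵀ at u.
∙-gram : ∀ (u : Fin k → ℤ) (M : Fin k → Fin l → ℤ) →
         (λ j → u ∙ λ i → M i j) ∙ (λ j → u ∙ λ i → M i j) ≡ u ∙ λ i → u ∙ λ i′ → M i ∙ M i′
∙-gram {l = l} u M = begin
  uM ∙ uM                              ≡⟨ ∙-assoc u M uM ⟨
  u ∙ (λ i → M i ∙ uM)                 ≡⟨ ∙-congˡ u (λ i → ∙-comm (M i) uM) ⟩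
  u ∙ (λ i → uM ∙ M i)                 ≡⟨ ∙-congˡ u (λ i → ∙-assoc u M (M i)) ⟨
  u ∙ (λ i → u ∙ λ i′ → M i′ ∙ M i)    ≡⟨ ∙-congˡ u (λ i → ∙-congˡ u λ i′ → ∙-comm (M i′) (M i)) ⟩
  u ∙ (λ i → u ∙ λ i′ → M i ∙ M i′)    ∎
  where
  uM : Fin l → ℤ
  uM j = u ∙ λ i → M i j

∙-square : ∀ (f g : Fin k → ℤ) c →
           (λ i → f i + c * g i) ∙ (λ i → f i + c * g i) ≡ f ∙ f + (c + c) * (f ∙ g) + c * c * (g ∙ g)
∙-square {k} f g c = begin
  h ∙ h                                                ≡⟨ split h ⟩
  h ∙ f + c * (h ∙ g)                                  ≡⟨ cong₂ (λ x y → x + c * y) (expand f) (expand g) ⟩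
  f ∙ f + c * (f ∙ g) + c * (g ∙ f + c * (g ∙ g))      ≡⟨ cong (λ x → f ∙ f + c * (f ∙ g) + c * (x + c * (g ∙ g))) (∙-comm g f) ⟩
  f ∙ f + c * (f ∙ g) + c * (f ∙ g + c * (g ∙ g))      ≡⟨ collect (f ∙ f) (f ∙ g) (g ∙ g) c ⟩
  f ∙ f + (c + c) * (f ∙ g) + c * c * (g ∙ g)          ∎
  where
  h : Fin k → ℤ
  h i = f i + c * g i
  split : ∀ u → u ∙ h ≡ u ∙ f + c * (u ∙ g)
  split u = trans (∙-+ u f (λ i → c * g i)) (cong (λ x → u ∙ f + x) (∙-scale u g c))
  expand : ∀ u → h ∙ u ≡ u ∙ f + c * (u ∙ g)
  expand u = trans (∙-comm h u) (split u)
  collect : ∀ x y z c → x + c * y + c * (y + c * z) ≡ x + (c + c) * y + c * c * z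
  collect = solve-∀

-- Positive definiteness and vectors of variance zero.

0≤i*i : ∀ i → 0ℤ ≤ i * i
0≤i*i (+ zero)  = ≤-refl
0≤i*i (+ suc n) = +≤+ z≤n
0≤i*i -[1+ n ]  = +≤+ z≤n

opaque
  unfolding _∙_

  ∙-nonNegative : ∀ (f : Fin k → ℤ) → 0ℤ ≤ f ∙ f
  ∙-nonNegative {zero}  f = ≤-refl
  ∙-nonNegative {suc k} f = +-mono-≤ (0≤i*i (f zero)) (∙-nonNegative (f ∘ suc))

  -- The tail is a sum of squares, so the square of the head is at most the vanishing total and must
  -- be zero. Removing it leaves the same situation for the tail.
  ∙-definite : ∀ (f : Fin k → ℤ) → f ∙ f ≡ 0ℤ → ∀ i → f i ≡ 0ℤ
  ∙-definite {suc k} f f∙f≡0 zero = Sum.reduce (i*j≡0⇒i≡0∨j≡0 (f zero) head≡0)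
    where
    head≡0 : f zero * f zero ≡ 0ℤ
    head≡0 = ≤-antisym
      (≤-trans (i≤i+j (f zero * f zero) ((f ∘ suc) ∙ (f ∘ suc)) {{nonNegative (∙-nonNegative (f ∘ suc))}})
               (≤-reflexive f∙f≡0))
      (0≤i*i (f zero))
  ∙-definite {suc k} f f∙f≡0 (suc i) = ∙-definite (f ∘ suc) tail≡0 i
    where
    tail≡0 : (f ∘ suc) ∙ (f ∘ suc) ≡ 0ℤ
    tail≡0 = begin
      (f ∘ suc) ∙ (f ∘ suc)                      ≡⟨ +-identityˡ _ ⟨
      0ℤ + (f ∘ suc) ∙ (f ∘ suc)                 ≡⟨ cong (λ x → x * x + (f ∘ suc) ∙ (f ∘ suc)) (∙-definite f f∙f≡0 zero) ⟨
      f zero * f zero + (f ∘ suc) ∙ (f ∘ suc)    ≡⟨ f∙f≡0 ⟩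
      0ℤ                                         ∎

  𝟏∙𝟏 : ∀ k → 𝟏 {k} ∙ 𝟏 ≡ + k
  𝟏∙𝟏 zero    = refl
  𝟏∙𝟏 (suc k) = cong (λ x → 1ℤ + x) (𝟏∙𝟏 k)

-- Equality in the Cauchy–Schwarz inequality for f and 𝟏: Σᵢ (f i - c)² = 0.
constant-entries : ∀ (f : Fin k → ℤ) c → f ∙ 𝟏 ≡ + k * c → f ∙ f ≡ + k * c * c → ∀ i → f i ≡ c
constant-entries {k} f c f∙𝟏 f∙f i = begin
  f i                          ≡⟨ shift (f i) c ⟩
  f i + - c * 1ℤ + c           ≡⟨ cong (_+ c) (∙-definite (λ i → f i + - c * 1ℤ) variance i) ⟩
  0ℤ + c                       ≡⟨ +-identityˡ c ⟩
  c                            ∎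
  where
  shift : ∀ x c → x ≡ x + - c * 1ℤ + c
  shift = solve-∀
  cancel : ∀ k c → k * c * c + (- c + - c) * (k * c) + - c * - c * k ≡ 0ℤ
  cancel = solve-∀
  variance : (λ i → f i + - c * 1ℤ) ∙ (λ i → f i + - c * 1ℤ) ≡ 0ℤ
  variance = begin
    (λ i → f i + - c * 1ℤ) ∙ (λ i → f i + - c * 1ℤ)
      ≡⟨ ∙-square f 𝟏 (- c) ⟩
    f ∙ f + (- c + - c) * (f ∙ 𝟏) + - c * - c * (𝟏 {k} ∙ 𝟏)
      ≡⟨ cong₂ (λ x y → x + (- c + - c) * y + - c * - c * (𝟏 {k} ∙ 𝟏)) f∙f f∙𝟏 ⟩
    + k * c * c + (- c + - c) * (+ k * c) + - c * - c * (𝟏 {k} ∙ 𝟏)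
      ≡⟨ cong (λ x → + k * c * c + (- c + - c) * (+ k * c) + - c * - c * x) (𝟏∙𝟏 k) ⟩
    + k * c * c + (- c + - c) * (+ k * c) + - c * - c * + k
      ≡⟨ cancel (+ k) c ⟩
    0ℤ ∎

-- Indicator vectors and cardinalities.

χ : Bool → ℤ
χ true  = 1ℤ
χ false = 0ℤ

χ-idem : ∀ b → χ b * χ b ≡ χ b * 1ℤ
χ-idem true  = refl
χ-idem false = refl

δ : Fin k → Fin k → ℤ
δ i j = χ (does (i ≟ j))

δ-refl : ∀ (i : Fin k) → δ i i ≡ 1ℤ
δ-refl i = cong χ (dec-true (i ≟ i) refl)

δ-≢ : ∀ {i j : Fin k} → i ≢ j → δ i j ≡ 0ℤ
δ-≢ {i = i} {j} i≢j = cong χ (dec-false (i ≟ j) i≢j)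

δ-sym : ∀ (i j : Fin k) → δ i j ≡ δ j i
δ-sym i j = cong χ (does-⇔ (mk⇔ sym sym) (i ≟ j) (j ≟ i))

opaque
  unfolding _∙_

  ∙-zero : ∀ (f : Fin k → ℤ) → f ∙ (λ _ → 0ℤ) ≡ 0ℤ
  ∙-zero {zero}  f = refl
  ∙-zero {suc k} f = cong₂ _+_ (*-zeroʳ (f zero)) (∙-zero (f ∘ suc))

  δ-∙ : ∀ (i : Fin k) (f : Fin k → ℤ) → δ i ∙ f ≡ f i
  δ-∙ zero f = begin
    1ℤ * f zero + (λ _ → 0ℤ) ∙ (f ∘ suc)   ≡⟨ cong₂ _+_ (*-identityˡ (f zero)) (trans (∙-comm (λ _ → 0ℤ) (f ∘ suc)) (∙-zero (f ∘ suc))) ⟩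
    f zero + 0ℤ                            ≡⟨ +-identityʳ (f zero) ⟩
    f zero                                 ∎
  δ-∙ (suc i) f = begin
    0ℤ * f zero + δ i ∙ (f ∘ suc)   ≡⟨ +-identityˡ (δ i ∙ (f ∘ suc)) ⟩
    δ i ∙ (f ∘ suc)                 ≡⟨ δ-∙ i (f ∘ suc) ⟩
    f (suc i)                       ∎

  -- 0 and 1 are their own squares. This turns diagonal entries of Gram matrices into sizes.
  χ-∙-idem : ∀ (b : Fin k → Bool) → (χ ∘ b) ∙ (χ ∘ b) ≡ (χ ∘ b) ∙ 𝟏
  χ-∙-idem b = sum-cong-≗ λ i → χ-idem (b i)

  ∣tabulate∣ : ∀ (b : Fin k → Bool) → + ∣ tabulate b ∣ ≡ (χ ∘ b) ∙ 𝟏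
  ∣tabulate∣ {zero}  b = refl
  ∣tabulate∣ {suc k} b with b zero
  ... | true  = cong (λ x → 1ℤ + x) (∣tabulate∣ (b ∘ suc))
  ... | false = trans (∣tabulate∣ (b ∘ suc)) (sym (+-identityˡ _))

  ∣tabulate∩tabulate∣ : ∀ (b c : Fin k → Bool) → + ∣ tabulate b ∩ tabulate c ∣ ≡ (χ ∘ b) ∙ (χ ∘ c)
  ∣tabulate∩tabulate∣ {zero}  b c = refl
  ∣tabulate∩tabulate∣ {suc k} b c with b zero | c zero
  ... | true  | true  = cong (λ x → 1ℤ + x) (∣tabulate∩tabulate∣ (b ∘ suc) (c ∘ suc))
  ... | true  | false = trans (∣tabulate∩tabulate∣ (b ∘ suc) (c ∘ suc)) (sym (+-identityˡ _))
  ... | false | true  = trans (∣tabulate∩tabulate∣ (b ∘ suc) (c ∘ suc)) (sym (+-identityˡ _))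
  ... | false | false = trans (∣tabulate∩tabulate∣ (b ∘ suc) (c ∘ suc)) (sym (+-identityˡ _))

  -- Serves to split a count over the vertices of `Γ` into its part in `Δ` and its part in the point
  -- set of the design.
  ∙-splitAt : ∀ k (f g : Fin k ⊎ Fin l → ℤ) →
              (f ∘ splitAt k) ∙ (g ∘ splitAt k) ≡ (f ∘ inj₁) ∙ (g ∘ inj₁) + (f ∘ inj₂) ∙ (g ∘ inj₂)
  ∙-splitAt zero    f g = sym (+-identityˡ _)
  ∙-splitAt (suc k) f g = begin
    f₀ + (f ∘ splitAt (suc k) ∘ suc) ∙ (g ∘ splitAt (suc k) ∘ suc)
      ≡⟨ cong (λ x → f₀ + x) (∙-splitAt k (f ∘ Sum.map₁ suc) (g ∘ Sum.map₁ suc)) ⟩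
    f₀ + ((f ∘ inj₁ ∘ suc) ∙ (g ∘ inj₁ ∘ suc) + (f ∘ inj₂) ∙ (g ∘ inj₂))
      ≡⟨ +-assoc f₀ _ _ ⟨
    f₀ + (f ∘ inj₁ ∘ suc) ∙ (g ∘ inj₁ ∘ suc) + (f ∘ inj₂) ∙ (g ∘ inj₂) ∎
    where
    f₀ : ℤ
    f₀ = f (inj₁ zero) * g (inj₁ zero)

-- `blockSize` measures the subset itself, whereas inner products measure tabulated truth values;
-- this reconciles the two.
tabulate-∈? : ∀ (p : Subset k) → tabulate (λ i → does (i ∈? p)) ≡ p
tabulate-∈? []            = refl
tabulate-∈? (inside ∷ p)  = cong (inside ∷_) (tabulate-∈? p)
tabulate-∈? (outside ∷ p) = cong (outside ∷_) (tabulate-∈? p)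

-- Numbers of neighbours of a vertex in the canonical classes.

module ClassDegrees {V K λ₁ λ₂ m n} (Δ : DivisibleDesignGraph V K λ₁ λ₂ m n) where
  open DivisibleDesignGraph Δ

  A : Fin V → Fin V → ℤ
  A x y = χ (does (x ~? y))

  A-sym : ∀ x y → A x y ≡ A y x
  A-sym x y = cong χ (does-⇔ (mk⇔ ~-sym ~-sym) (x ~? y) (y ~? x))

  -- With the arguments of `δ` in this order, `A x ∙ S y` is definitionally
  -- `classDegree x (class y)`.
  S : Fin V → Fin V → ℤ
  S y z = δ (class z) (class y)

  classDegree : Fin V → Fin m → ℤ
  classDegree x i = A x ∙ λ y → δ (class y) i

  A∙𝟏 : ∀ x → A x ∙ 𝟏 ≡ + K
  A∙𝟏 x = trans (sym (∣tabulate∣ (λ y → does (x ~? y)))) (cong +_ (regular x))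

  class∙𝟏 : ∀ i → (λ x → δ (class x) i) ∙ 𝟏 ≡ + n
  class∙𝟏 i = trans (sym (∣tabulate∣ (λ x → does (class x ≟ i)))) (cong +_ (classSize i))

  𝟏∙class : ∀ i → 𝟏 ∙ (λ x → δ (class x) i) ≡ + n
  𝟏∙class i = trans (∙-comm 𝟏 (λ x → δ (class x) i)) (class∙𝟏 i)

  S∙S : ∀ x → S x ∙ S x ≡ + n
  S∙S x = trans (χ-∙-idem (λ y → does (class y ≟ class x))) (class∙𝟏 (class x))

  commonNeighbours-∙ : ∀ x y → + commonNeighbours x y ≡ A x ∙ A y
  commonNeighbours-∙ x y = ∣tabulate∩tabulate∣ (λ z → does (x ~? z)) (λ z → does (y ~? z))

  -- The cases are equal vertices (where the entry is the degree), distinct vertices of one class,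
  -- and different classes. The factor `1ℤ` is an entry of `𝟏`, as `∙-linear₃` expects.
  A∙A : ∀ x y → A x ∙ A y ≡ (+ K - + λ₁) * δ x y + (+ λ₁ - + λ₂) * S x y + + λ₂ * 1ℤ
  A∙A x y with x ≟ y
  ... | yes refl = begin
    A x ∙ A x                                               ≡⟨ χ-∙-idem (λ z → does (x ~? z)) ⟩
    A x ∙ 𝟏                                                 ≡⟨ A∙𝟏 x ⟩
    + K                                                     ≡⟨ collect (+ K) (+ λ₁) (+ λ₂) ⟩
    (+ K - + λ₁) * 1ℤ + (+ λ₁ - + λ₂) * 1ℤ + + λ₂ * 1ℤ
      ≡⟨ cong (λ s → (+ K - + λ₁) * 1ℤ + (+ λ₁ - + λ₂) * s + + λ₂ * 1ℤ) (δ-refl (class x)) ⟨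
    (+ K - + λ₁) * 1ℤ + (+ λ₁ - + λ₂) * S x x + + λ₂ * 1ℤ   ∎
    where
    collect : ∀ K a b → K ≡ (K - a) * 1ℤ + (a - b) * 1ℤ + b * 1ℤ
    collect = solve-∀
  -- The comparison is in this order because it is the one inside `S x y`, which then reduces.
  ... | no x≢y with class y ≟ class x
  ...   | yes same = begin
    A x ∙ A y                                            ≡⟨ commonNeighbours-∙ x y ⟨
    + commonNeighbours x y                               ≡⟨ cong +_ (sameClass x y x≢y (sym same)) ⟩
    + λ₁                                                 ≡⟨ collect (+ K) (+ λ₁) (+ λ₂) ⟩
    (+ K - + λ₁) * 0ℤ + (+ λ₁ - + λ₂) * 1ℤ + + λ₂ * 1ℤ   ∎
    where
    collect : ∀ K a b → a ≡ (K - a) * 0ℤ + (a - b) * 1ℤ + b * 1ℤ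
    collect = solve-∀
  ...   | no differ = begin
    A x ∙ A y                                            ≡⟨ commonNeighbours-∙ x y ⟨
    + commonNeighbours x y                               ≡⟨ cong +_ (differentClass x y (differ ∘ sym)) ⟩
    + λ₂                                                 ≡⟨ collect (+ K) (+ λ₁) (+ λ₂) ⟩
    (+ K - + λ₁) * 0ℤ + (+ λ₁ - + λ₂) * 0ℤ + + λ₂ * 1ℤ   ∎
    where
    collect : ∀ K a b → b ≡ (K - a) * 0ℤ + (a - b) * 0ℤ + b * 1ℤ
    collect = solve-∀

  -- The two sides are the (x, y) entries of A·A² and A²·A, since A is symmetric; they agree by
  -- associativity.
  A³-sym : ∀ x y → A x ∙ (λ z → A y ∙ A z) ≡ A y ∙ (λ z → A x ∙ A z)
  A³-sym x y = begin
    A x ∙ (λ z → A y ∙ A z)            ≡⟨ ∙-congˡ (A x) (λ z → ∙-comm (A y) (A z)) ⟩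
    A x ∙ (λ z → A z ∙ A y)            ≡⟨ ∙-assoc (A x) A (A y) ⟩
    (λ w → A x ∙ λ z → A z w) ∙ A y    ≡⟨ ∙-congʳ (A y) (λ w → ∙-congˡ (A x) λ z → A-sym z w) ⟩
    (λ w → A x ∙ A w) ∙ A y            ≡⟨ ∙-comm (λ w → A x ∙ A w) (A y) ⟩
    A y ∙ (λ w → A x ∙ A w)            ∎

  -- Pairs row `x` of A with the formula for A²: the identity part picks out `A x y`, the class part
  -- a class degree, and the all-ones part the degree `K`.
  A³ : ∀ x y → A x ∙ (λ z → A y ∙ A z) ≡
               (+ K - + λ₁) * A x y + (+ λ₁ - + λ₂) * classDegree x (class y) + + λ₂ * + K
  A³ x y = begin
    A x ∙ (λ z → A y ∙ A z)
      ≡⟨ ∙-congˡ (A x) (A∙A y) ⟩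
    A x ∙ (λ z → (+ K - + λ₁) * δ y z + (+ λ₁ - + λ₂) * S y z + + λ₂ * 1ℤ)
      ≡⟨ ∙-linear₃ (A x) (δ y) (S y) 𝟏 (+ K - + λ₁) (+ λ₁ - + λ₂) (+ λ₂) ⟩
    (+ K - + λ₁) * (A x ∙ δ y) + (+ λ₁ - + λ₂) * classDegree x (class y) + + λ₂ * (A x ∙ 𝟏)
      ≡⟨ cong₂ (λ d k → (+ K - + λ₁) * d + (+ λ₁ - + λ₂) * classDegree x (class y) + + λ₂ * k)
               (trans (∙-comm (A x) (δ y)) (δ-∙ y (A x))) (A∙𝟏 x) ⟩
    (+ K - + λ₁) * A x y + (+ λ₁ - + λ₂) * classDegree x (class y) + + λ₂ * + K ∎

  -- This is AS = SA entrywise. In the two expansions of the symmetric matrix A³ the terms in A and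
  -- in J agree, so the class terms agree too, and their coefficient can be cancelled.
  classDegree-sym : .{{NonZero (+ λ₁ - + λ₂)}} →
                    ∀ x y → classDegree x (class y) ≡ classDegree y (class x)
  classDegree-sym x y = *-cancelˡ-≡ (+ λ₁ - + λ₂) _ _ (begin
    d * classDegree x (class y)
      -- Adding and subtracting the other two terms exposes the whole entry of A³, which can then be
      -- transposed.
      ≡⟨ isolate (c * A x y) (d * classDegree x (class y)) (+ λ₂ * + K) ⟩
    c * A x y + d * classDegree x (class y) + + λ₂ * + K - c * A x y - + λ₂ * + K
      ≡⟨ cong (λ t → t - c * A x y - + λ₂ * + K) (trans (sym (A³ x y)) (trans (A³-sym x y) (A³ y x))) ⟩
    c * A y x + d * classDegree y (class x) + + λ₂ * + K - c * A x y - + λ₂ * + K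
      ≡⟨ cong (λ t → c * A y x + d * classDegree y (class x) + + λ₂ * + K - c * t - + λ₂ * + K) (A-sym x y) ⟩
    c * A y x + d * classDegree y (class x) + + λ₂ * + K - c * A y x - + λ₂ * + K
      ≡⟨ isolate (c * A y x) (d * classDegree y (class x)) (+ λ₂ * + K) ⟨
    d * classDegree y (class x) ∎)
    where
    c d : ℤ
    c = + K - + λ₁
    d = + λ₁ - + λ₂
    isolate : ∀ a b c → b ≡ a + b + c - a - c
    isolate = solve-∀

  -- Each neighbour of `x` lies in exactly one class.
  classDegree∙𝟏 : ∀ x → classDegree x ∙ 𝟏 ≡ + K
  classDegree∙𝟏 x = begin
    classDegree x ∙ 𝟏                      ≡⟨ ∙-assoc (A x) (λ y → δ (class y)) 𝟏 ⟨
    A x ∙ (λ y → δ (class y) ∙ 𝟏)          ≡⟨ ∙-congˡ (A x) (λ y → δ-∙ (class y) 𝟏) ⟩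
    A x ∙ 𝟏                                ≡⟨ A∙𝟏 x ⟩
    + K                                    ∎

  -- The sum of squares counts ordered pairs of neighbours of `x` in a common class. By
  -- `classDegree-sym` this equals the number of walks of length two from `x` into its own class:
  -- `K` of them return to `x`, and `λ₁` end at each of the other `n - 1` vertices.
  classDegree∙classDegree : .{{NonZero (+ λ₁ - + λ₂)}} →
                            ∀ x → classDegree x ∙ classDegree x ≡ + K + + λ₁ * (+ n - 1ℤ)
  classDegree∙classDegree x = begin
    classDegree x ∙ classDegree x
      ≡⟨ ∙-gram (A x) (λ y → δ (class y)) ⟩
    A x ∙ (λ y → A x ∙ λ z → δ (class y) ∙ δ (class z))
      ≡⟨ ∙-congˡ (A x) (λ y → ∙-congˡ (A x) λ z →
           trans (∙-comm (δ (class y)) (δ (class z))) (δ-∙ (class z) (δ (class y)))) ⟩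
    A x ∙ (λ y → A x ∙ λ z → δ (class y) (class z))
      ≡⟨ ∙-congˡ (A x) (λ y → ∙-congˡ (A x) λ z → δ-sym (class y) (class z)) ⟩
    A x ∙ (λ y → classDegree x (class y))
      ≡⟨ ∙-congˡ (A x) (λ y → classDegree-sym x y) ⟩
    A x ∙ (λ y → A y ∙ S x)
      ≡⟨ ∙-assoc (A x) A (S x) ⟩
    (λ z → A x ∙ λ y → A y z) ∙ S x
      ≡⟨ ∙-congʳ (S x) (λ z → trans (∙-congˡ (A x) λ y → A-sym y z) (A∙A x z)) ⟩
    (λ z → (+ K - + λ₁) * δ x z + (+ λ₁ - + λ₂) * S x z + + λ₂ * 1ℤ) ∙ S x
      ≡⟨ ∙-comm _ (S x) ⟩
    S x ∙ (λ z → (+ K - + λ₁) * δ x z + (+ λ₁ - + λ₂) * S x z + + λ₂ * 1ℤ)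
      ≡⟨ ∙-linear₃ (S x) (δ x) (S x) 𝟏 (+ K - + λ₁) (+ λ₁ - + λ₂) (+ λ₂) ⟩
    (+ K - + λ₁) * (S x ∙ δ x) + (+ λ₁ - + λ₂) * (S x ∙ S x) + + λ₂ * (S x ∙ 𝟏)
      ≡⟨ cong₂ (λ a b → (+ K - + λ₁) * a + (+ λ₁ - + λ₂) * (S x ∙ S x) + + λ₂ * b)
               (trans (∙-comm (S x) (δ x)) (trans (δ-∙ x (S x)) (δ-refl (class x)))) (class∙𝟏 (class x)) ⟩
    (+ K - + λ₁) * 1ℤ + (+ λ₁ - + λ₂) * (S x ∙ S x) + + λ₂ * + n
      ≡⟨ cong (λ a → (+ K - + λ₁) * 1ℤ + (+ λ₁ - + λ₂) * a + + λ₂ * + n) (S∙S x) ⟩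
    (+ K - + λ₁) * 1ℤ + (+ λ₁ - + λ₂) * + n + + λ₂ * + n
      ≡⟨ collect (+ K) (+ λ₁) (+ λ₂) (+ n) ⟩
    + K + + λ₁ * (+ n - 1ℤ) ∎
    where
    collect : ∀ K a b n → (K - a) * 1ℤ + (a - b) * n + b * n ≡ K + a * (n - 1ℤ)
    collect = solve-∀

  classDegree-constant : .{{NonZero (+ λ₁ - + λ₂)}} →
                         ∀ t → + K ≡ + m * t → + K + + λ₁ * (+ n - 1ℤ) ≡ + m * t * t →
                         ∀ x i → classDegree x i ≡ t
  classDegree-constant t K≡ eq x = constant-entries (classDegree x) t
    (trans (classDegree∙𝟏 x) K≡) (trans (classDegree∙classDegree x) eq)

  ∙-class : ∀ w (g : Fin m → ℤ) → w ∙ (g ∘ class) ≡ (λ i → w ∙ λ y → δ (class y) i) ∙ g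
  ∙-class w g = begin
    w ∙ (g ∘ class)                        ≡⟨ ∙-congˡ w (λ y → δ-∙ (class y) g) ⟨
    w ∙ (λ y → δ (class y) ∙ g)            ≡⟨ ∙-assoc w (λ y → δ (class y)) g ⟩
    (λ i → w ∙ λ y → δ (class y) i) ∙ g    ∎

  -- Groups the vertices by class. It is applied to a row of A, where `c` is `t`, and to `𝟏`, where
  -- `c` is the class size.
  ∙-class-constant : ∀ w c → (∀ i → w ∙ (λ y → δ (class y) i) ≡ c) →
                     ∀ (g : Fin m → ℤ) → w ∙ (g ∘ class) ≡ c * (g ∙ 𝟏)
  ∙-class-constant w c eq g = begin
    w ∙ (g ∘ class)                        ≡⟨ ∙-class w g ⟩
    (λ i → w ∙ λ y → δ (class y) i) ∙ g    ≡⟨ ∙-congʳ g eq ⟩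
    (λ _ → c) ∙ g                          ≡⟨ ∙-comm (λ _ → c) g ⟩
    g ∙ (λ _ → c)                          ≡⟨ ∙-const g c ⟩
    c * (g ∙ 𝟏)                            ∎

-- Point degrees and block intersections in a symmetric design.

module Replication {m κ ℓ} (𝒟 : SymmetricDesign m κ ℓ) .{{_ : NonZero (+ κ - 1ℤ)}}
                   (count : + ℓ * (+ m - 1ℤ) ≡ + κ * (+ κ - 1ℤ)) where
  open SymmetricDesign 𝒟

  I : Fin m → Fin m → ℤ
  I p b = χ (does (p ∈? block b))

  column : Fin m → Fin m → ℤ
  column b p = I p b

  column∙𝟏 : ∀ b → column b ∙ 𝟏 ≡ + κ
  column∙𝟏 b = begin
    column b ∙ 𝟏                                     ≡⟨ ∣tabulate∣ (λ p → does (p ∈? block b)) ⟨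
    + ∣ tabulate (λ p → does (p ∈? block b)) ∣       ≡⟨ cong (λ B → + ∣ B ∣) (tabulate-∈? (block b)) ⟩
    + ∣ block b ∣                                    ≡⟨ cong +_ (blockSize b) ⟩
    + κ                                              ∎

  I∙I-≢ : ∀ {p q} → p ≢ q → I p ∙ I q ≡ + ℓ
  I∙I-≢ {p} {q} p≢q = trans
    (sym (∣tabulate∩tabulate∣ (λ b → does (p ∈? block b)) (λ b → does (q ∈? block b))))
    (cong +_ (balanced p q p≢q))

  -- The diagonal keeps the number of blocks through `p` as the unknown `I p ∙ 𝟏`, which
  -- `replication` determines from this formula.
  I∙I : ∀ p q → I p ∙ I q ≡ (I p ∙ 𝟏 - + ℓ) * δ p q + + ℓ * 1ℤ
  I∙I p q with p ≟ q
  ... | yes refl = trans (χ-∙-idem (λ b → does (p ∈? block b))) (collect (I p ∙ 𝟏) (+ ℓ))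
    where
    collect : ∀ r l → r ≡ (r - l) * 1ℤ + l * 1ℤ
    collect = solve-∀
  ... | no p≢q = trans (I∙I-≢ p≢q) (collect (I p ∙ 𝟏) (+ ℓ))
    where
    collect : ∀ r l → l ≡ (r - l) * 0ℤ + l * 1ℤ
    collect = solve-∀

  -- Both sides count the incident pairs (q , b) with p ∈ b and q ∈ b.
  flags : ∀ p → + κ * (I p ∙ 𝟏) ≡ I p ∙ 𝟏 - + ℓ + + ℓ * + m
  flags p = begin
    + κ * (I p ∙ 𝟏)                               ≡⟨ ∙-const (I p) (+ κ) ⟨
    I p ∙ (λ _ → + κ)                             ≡⟨ ∙-congˡ (I p) column∙𝟏 ⟨
    I p ∙ (λ b → column b ∙ 𝟏)                    ≡⟨ ∙-assoc (I p) column 𝟏 ⟩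
    (λ q → I p ∙ I q) ∙ 𝟏                         ≡⟨ ∙-comm (λ q → I p ∙ I q) 𝟏 ⟩
    𝟏 ∙ (λ q → I p ∙ I q)                         ≡⟨ ∙-congˡ 𝟏 (I∙I p) ⟩
    𝟏 ∙ (λ q → (r - + ℓ) * δ p q + + ℓ * 1ℤ)      ≡⟨ ∙-linear 𝟏 (δ p) 𝟏 (r - + ℓ) (+ ℓ) ⟩
    (r - + ℓ) * (𝟏 ∙ δ p) + + ℓ * (𝟏 {m} ∙ 𝟏)     ≡⟨ cong₂ (λ x y → (r - + ℓ) * x + + ℓ * y)
                                                       (trans (∙-comm 𝟏 (δ p)) (δ-∙ p 𝟏)) (𝟏∙𝟏 m) ⟩
    (r - + ℓ) * 1ℤ + + ℓ * + m                    ≡⟨ cong (_+ + ℓ * + m) (*-identityʳ (r - + ℓ)) ⟩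
    r - + ℓ + + ℓ * + m                           ∎
    where
    r : ℤ
    r = I p ∙ 𝟏

  -- Rearranged, `flags` reads (κ - 1) r = ℓ (m - 1). By `count` the right side is (κ - 1) κ, and κ
  -- - 1 is nonzero.
  replication : ∀ p → I p ∙ 𝟏 ≡ + κ
  replication p = *-cancelˡ-≡ (+ κ - 1ℤ) _ _ (begin
    (+ κ - 1ℤ) * r                       ≡⟨ expand (+ κ) r ⟩
    + κ * r - r                          ≡⟨ cong (_- r) (flags p) ⟩
    r - + ℓ + + ℓ * + m - r              ≡⟨ collect r (+ ℓ) (+ m) ⟩
    + ℓ * (+ m - 1ℤ)                     ≡⟨ count ⟩
    + κ * (+ κ - 1ℤ)                     ≡⟨ *-comm (+ κ) (+ κ - 1ℤ) ⟩
    (+ κ - 1ℤ) * + κ                     ∎)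
    where
    r : ℤ
    r = I p ∙ 𝟏
    expand : ∀ k r → (k - 1ℤ) * r ≡ k * r - r
    expand = solve-∀
    collect : ∀ r l m → r - l + l * m - r ≡ l * (m - 1ℤ)
    collect = solve-∀

  module _ (b : Fin m) where
    private
      meet : Fin m → ℤ
      meet b′ = column b ∙ column b′

      meet-b : meet b ≡ + κ
      meet-b = trans (χ-∙-idem (λ p → does (p ∈? block b))) (column∙𝟏 b)

      -- Each of the `κ` points of `b` lies on `κ` blocks.
      meet∙𝟏 : meet ∙ 𝟏 ≡ + κ * + κ
      meet∙𝟏 = begin
        meet ∙ 𝟏                        ≡⟨ ∙-assoc (column b) I 𝟏 ⟨
        column b ∙ (λ p → I p ∙ 𝟏)      ≡⟨ ∙-congˡ (column b) replication ⟩
        column b ∙ (λ p → + κ)          ≡⟨ ∙-const (column b) (+ κ) ⟩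
        + κ * (column b ∙ 𝟏)            ≡⟨ cong (+ κ *_) (column∙𝟏 b) ⟩
        + κ * + κ                       ∎

      -- By `replication` the Gram matrix of the rows is (κ - ℓ) I + ℓ J; it is evaluated as a
      -- quadratic form at the indicator vector of `b`.
      meet∙meet : meet ∙ meet ≡ (+ κ - + ℓ) * + κ + + ℓ * + κ * + κ
      meet∙meet = begin
        meet ∙ meet
          ≡⟨ ∙-gram (column b) I ⟩
        column b ∙ (λ p → column b ∙ λ q → I p ∙ I q)
          ≡⟨ ∙-congˡ (column b) row ⟩
        column b ∙ (λ p → (+ κ - + ℓ) * column b p + (+ ℓ * + κ) * 1ℤ)
          ≡⟨ ∙-linear (column b) (column b) 𝟏 (+ κ - + ℓ) (+ ℓ * + κ) ⟩
        (+ κ - + ℓ) * meet b + (+ ℓ * + κ) * (column b ∙ 𝟏)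
          ≡⟨ cong₂ (λ x y → (+ κ - + ℓ) * x + (+ ℓ * + κ) * y) meet-b (column∙𝟏 b) ⟩
        (+ κ - + ℓ) * + κ + + ℓ * + κ * + κ ∎
        where
        row : ∀ p → column b ∙ (λ q → I p ∙ I q) ≡ (+ κ - + ℓ) * column b p + (+ ℓ * + κ) * 1ℤ
        row p = begin
          column b ∙ (λ q → I p ∙ I q)
            ≡⟨ ∙-congˡ (column b) (I∙I p) ⟩
          column b ∙ (λ q → (I p ∙ 𝟏 - + ℓ) * δ p q + + ℓ * 1ℤ)
            ≡⟨ ∙-linear (column b) (δ p) 𝟏 (I p ∙ 𝟏 - + ℓ) (+ ℓ) ⟩
          (I p ∙ 𝟏 - + ℓ) * (column b ∙ δ p) + + ℓ * (column b ∙ 𝟏)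
            ≡⟨ cong₂ (λ r y → (r - + ℓ) * y + + ℓ * (column b ∙ 𝟏)) (replication p)
                     (trans (∙-comm (column b) (δ p)) (δ-∙ p (column b))) ⟩
          (+ κ - + ℓ) * column b p + + ℓ * (column b ∙ 𝟏)
            ≡⟨ cong (λ y → (+ κ - + ℓ) * column b p + y)
                    (trans (cong (+ ℓ *_) (column∙𝟏 b)) (sym (*-identityʳ (+ ℓ * + κ)))) ⟩
          (+ κ - + ℓ) * column b p + (+ ℓ * + κ) * 1ℤ ∎

      -- meet with its entry at b lowered from κ to ℓ, which makes it a constant vector.
      meet′ : Fin m → ℤ
      meet′ b′ = meet b′ + - (+ κ - + ℓ) * δ b b′

      -- The lowered total is κ² - (κ - ℓ) = κ (κ - 1) + ℓ, which `count` turns into m ℓ.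
      meet′∙𝟏 : meet′ ∙ 𝟏 ≡ + m * + ℓ
      meet′∙𝟏 = begin
        meet′ ∙ 𝟏
          ≡⟨ ∙-comm meet′ 𝟏 ⟩
        𝟏 ∙ meet′
          ≡⟨ ∙-+ 𝟏 meet (λ b′ → - (+ κ - + ℓ) * δ b b′) ⟩
        𝟏 ∙ meet + 𝟏 ∙ (λ b′ → - (+ κ - + ℓ) * δ b b′)
          ≡⟨ cong₂ _+_ (trans (∙-comm 𝟏 meet) meet∙𝟏) (∙-scale 𝟏 (δ b) (- (+ κ - + ℓ))) ⟩
        + κ * + κ + - (+ κ - + ℓ) * (𝟏 ∙ δ b)
          ≡⟨ cong (λ x → + κ * + κ + - (+ κ - + ℓ) * x) (trans (∙-comm 𝟏 (δ b)) (δ-∙ b 𝟏)) ⟩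
        + κ * + κ + - (+ κ - + ℓ) * 1ℤ
          ≡⟨ collect (+ κ) (+ ℓ) ⟩
        + κ * (+ κ - 1ℤ) + + ℓ
          ≡⟨ cong (_+ + ℓ) count ⟨
        + ℓ * (+ m - 1ℤ) + + ℓ
          ≡⟨ collect₂ (+ ℓ) (+ m) ⟩
        + m * + ℓ ∎
        where
        collect : ∀ k l → k * k + - (k - l) * 1ℤ ≡ k * (k - 1ℤ) + l
        collect = solve-∀
        collect₂ : ∀ l m → l * (m - 1ℤ) + l ≡ m * l
        collect₂ = solve-∀

      -- Lowering the entry replaces κ² by ℓ² in the sum of squares. What remains is (κ (κ - 1) + ℓ)
      -- ℓ, and `count` applies again.
      meet′∙meet′ : meet′ ∙ meet′ ≡ + m * + ℓ * + ℓ
      meet′∙meet′ = begin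
        meet′ ∙ meet′
          ≡⟨ ∙-square meet (δ b) c ⟩
        meet ∙ meet + (c + c) * (meet ∙ δ b) + c * c * (δ b ∙ δ b)
          ≡⟨ cong₂ (λ x y → x + (c + c) * y + c * c * (δ b ∙ δ b)) meet∙meet
                   (trans (∙-comm meet (δ b)) (trans (δ-∙ b meet) meet-b)) ⟩
        (+ κ - + ℓ) * + κ + + ℓ * + κ * + κ + (c + c) * + κ + c * c * (δ b ∙ δ b)
          ≡⟨ cong (λ x → (+ κ - + ℓ) * + κ + + ℓ * + κ * + κ + (c + c) * + κ + c * c * x)
                  (trans (δ-∙ b (δ b)) (δ-refl b)) ⟩
        (+ κ - + ℓ) * + κ + + ℓ * + κ * + κ + (c + c) * + κ + c * c * 1ℤ
          ≡⟨ collect (+ κ) (+ ℓ) ⟩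
        (+ κ * (+ κ - 1ℤ) + + ℓ) * + ℓ
          ≡⟨ cong (λ x → (x + + ℓ) * + ℓ) count ⟨
        (+ ℓ * (+ m - 1ℤ) + + ℓ) * + ℓ
          ≡⟨ collect₂ (+ ℓ) (+ m) ⟩
        + m * + ℓ * + ℓ ∎
        where
        c : ℤ
        c = - (+ κ - + ℓ)
        collect : ∀ k l → (k - l) * k + l * k * k + (- (k - l) + - (k - l)) * k + - (k - l) * - (k - l) * 1ℤ
                        ≡ (k * (k - 1ℤ) + l) * l
        collect = solve-∀
        collect₂ : ∀ l m → (l * (m - 1ℤ) + l) * l ≡ m * l * l
        collect₂ = solve-∀

    -- Away from `b` the vectors `meet` and `meet′` agree, and `meet′` has mean `ℓ` and variance
    -- zero.
    column∙column-≢ : ∀ {b′} → b ≢ b′ → column b ∙ column b′ ≡ + ℓ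
    column∙column-≢ {b′} b≢b′ = begin
      meet b′                           ≡⟨ +-identityʳ (meet b′) ⟨
      meet b′ + 0ℤ                      ≡⟨ cong (λ x → meet b′ + x) (*-zeroʳ (- (+ κ - + ℓ))) ⟨
      meet b′ + - (+ κ - + ℓ) * 0ℤ      ≡⟨ cong (λ x → meet b′ + - (+ κ - + ℓ) * x) (δ-≢ b≢b′) ⟨
      meet′ b′                          ≡⟨ constant-entries meet′ (+ ℓ) meet′∙𝟏 meet′∙meet′ b′ ⟩
      + ℓ                               ∎

-- Degrees and common neighbours in the extended graph.

module Extension {V K λ₁ λ₂ m n κ ℓ : ℕ} (Δ : DivisibleDesignGraph V K λ₁ λ₂ m n)
                 (𝒟 : SymmetricDesign m κ ℓ) (φ : Fin m ⤖ Fin m) (t : ℤ)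
                 (count : + ℓ * (+ m - 1ℤ) ≡ + κ * (+ κ - 1ℤ))
                 .{{_ : NonZero (+ κ - 1ℤ)}} .{{_ : NonZero (+ λ₁ - + λ₂)}}
                 (K≡ : + K ≡ + m * t) (K+λ₁[n-1]≡ : + K + + λ₁ * (+ n - 1ℤ) ≡ + m * t * t)
                 (ℓn≡ : + ℓ * + n ≡ + κ * t) (λ₁+κ≡ : + λ₁ + + κ ≡ + κ * t)
                 (λ₂+ℓ≡ : + λ₂ + + ℓ ≡ + κ * t) (K+κ≡ : + K + + κ ≡ + κ * + n) where
  open DivisibleDesignGraph Δ using (class; sameClass; differentClass)
  open ClassDegrees Δ
  open Replication 𝒟 count
  open Bijection φ using (to; injective)

  Γ-row : Fin V ⊎ Fin m → Fin V ⊎ Fin m → ℤ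
  Γ-row u w = χ (does (adjacent? Δ 𝒟 φ u w))

  Γ-row-∙ : ∀ u f → (Γ-row u ∘ splitAt V) ∙ (f ∘ splitAt V) ≡
            (Γ-row u ∘ inj₁) ∙ (f ∘ inj₁) + (Γ-row u ∘ inj₂) ∙ (f ∘ inj₂)
  Γ-row-∙ u f = ∙-splitAt V (Γ-row u) f

  -- A vertex gains the `κ` points of its block. A point is joined to the `κ` whole classes, of `n`
  -- vertices each, whose blocks contain it.
  degree-Γ : ∀ u → (Γ-row u ∘ splitAt V) ∙ 𝟏 ≡ + κ * + n
  degree-Γ (inj₁ x) = begin
    (Γ-row (inj₁ x) ∘ splitAt V) ∙ 𝟏          ≡⟨ Γ-row-∙ (inj₁ x) (λ _ → 1ℤ) ⟩
    A x ∙ 𝟏 + column (to (class x)) ∙ 𝟏       ≡⟨ cong₂ _+_ (A∙𝟏 x) (column∙𝟏 (to (class x))) ⟩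
    + K + + κ                                 ≡⟨ K+κ≡ ⟩
    + κ * + n                                 ∎
  degree-Γ (inj₂ p) = begin
    (Γ-row (inj₂ p) ∘ splitAt V) ∙ 𝟏              ≡⟨ Γ-row-∙ (inj₂ p) (λ _ → 1ℤ) ⟩
    (I p ∘ to ∘ class) ∙ 𝟏 + (λ _ → 0ℤ) ∙ 𝟏 {m}   ≡⟨ cong₂ _+_ (∙-comm (I p ∘ to ∘ class) 𝟏) (trans (∙-comm (λ _ → 0ℤ) 𝟏) (∙-zero 𝟏)) ⟩
    𝟏 ∙ (I p ∘ to ∘ class) + 0ℤ                   ≡⟨ +-identityʳ _ ⟩
    𝟏 ∙ (I p ∘ to ∘ class)                        ≡⟨ ∙-class-constant 𝟏 (+ n) 𝟏∙class (I p ∘ to) ⟩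
    + n * ((I p ∘ to) ∙ 𝟏)                        ≡⟨ cong (+ n *_) (trans (∙-permute (I p) 𝟏 φ) (replication p)) ⟩
    + n * + κ                                     ≡⟨ *-comm (+ n) (+ κ) ⟩
    + κ * + n                                     ∎

  classDegree≡t : ∀ x i → classDegree x i ≡ t
  classDegree≡t = classDegree-constant t K≡ K+λ₁[n-1]≡

  -- Points are pairwise nonadjacent, so only vertices of `Δ` count. The neighbours of `p` fill `κ`
  -- classes, and `x` has `t` neighbours in each.
  commonNeighbours-vertex-point : ∀ x p → (Γ-row (inj₁ x) ∘ splitAt V) ∙ (Γ-row (inj₂ p) ∘ splitAt V) ≡ + κ * t
  commonNeighbours-vertex-point x p = begin
    (Γ-row (inj₁ x) ∘ splitAt V) ∙ (Γ-row (inj₂ p) ∘ splitAt V)   ≡⟨ Γ-row-∙ (inj₁ x) (Γ-row (inj₂ p)) ⟩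
    A x ∙ (I p ∘ to ∘ class) + column (to (class x)) ∙ (λ _ → 0ℤ) ≡⟨ cong (λ c → A x ∙ (I p ∘ to ∘ class) + c) (∙-zero (column (to (class x)))) ⟩
    A x ∙ (I p ∘ to ∘ class) + 0ℤ                                 ≡⟨ +-identityʳ _ ⟩
    A x ∙ (I p ∘ to ∘ class)                                      ≡⟨ ∙-class-constant (A x) t (classDegree≡t x) (I p ∘ to) ⟩
    t * ((I p ∘ to) ∙ 𝟏)                                          ≡⟨ cong (t *_) (trans (∙-permute (I p) 𝟏 φ) (replication p)) ⟩
    t * + κ                                                       ≡⟨ *-comm t (+ κ) ⟩
    + κ * t                                                       ∎

  commonNeighbours-Γ : ∀ u w → u ≢ w → (Γ-row u ∘ splitAt V) ∙ (Γ-row w ∘ splitAt V) ≡ + κ * t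
  commonNeighbours-Γ (inj₁ x) (inj₂ p) _ = commonNeighbours-vertex-point x p
  commonNeighbours-Γ (inj₂ p) (inj₁ x) _ = trans (∙-comm (Γ-row (inj₂ p) ∘ splitAt V) (Γ-row (inj₁ x) ∘ splitAt V))
                                                 (commonNeighbours-vertex-point x p)
  commonNeighbours-Γ (inj₁ x) (inj₁ y) x≢y = trans (Γ-row-∙ (inj₁ x) (Γ-row (inj₁ y))) (case (class x ≟ class y))
    where
    case : Dec (class x ≡ class y) → A x ∙ A y + column (to (class x)) ∙ column (to (class y)) ≡ + κ * t
    -- Equal classes give equal blocks, so the points adjacent to both vertices form the whole
    -- block.
    case (yes same) = begin
      A x ∙ A y + column (to (class x)) ∙ column (to (class y))
        ≡⟨ cong₂ _+_ (trans (sym (commonNeighbours-∙ x y)) (cong +_ (sameClass x y (x≢y ∘ cong inj₁) same)))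
                     (cong (λ i → column (to (class x)) ∙ column (to i)) (sym same)) ⟩
      + λ₁ + column (to (class x)) ∙ column (to (class x))
        ≡⟨ cong (λ c → + λ₁ + c) (trans (χ-∙-idem (λ p → does (p ∈? _))) (column∙𝟏 (to (class x)))) ⟩
      + λ₁ + + κ
        ≡⟨ λ₁+κ≡ ⟩
      + κ * t ∎
    -- `φ` is injective, so the two blocks are distinct and meet in `ℓ` points.
    case (no differ) = begin
      A x ∙ A y + column (to (class x)) ∙ column (to (class y))
        ≡⟨ cong₂ _+_ (trans (sym (commonNeighbours-∙ x y)) (cong +_ (differentClass x y differ)))
                     (column∙column-≢ (to (class x)) (differ ∘ injective)) ⟩
      + λ₂ + + ℓ
        ≡⟨ λ₂+ℓ≡ ⟩
      + κ * t ∎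
  commonNeighbours-Γ (inj₂ p) (inj₂ q) p≢q = begin
    (Γ-row (inj₂ p) ∘ splitAt V) ∙ (Γ-row (inj₂ q) ∘ splitAt V)
      ≡⟨ Γ-row-∙ (inj₂ p) (Γ-row (inj₂ q)) ⟩
    (I p ∘ to ∘ class) ∙ (I q ∘ to ∘ class) + (λ (_ : Fin m) → 0ℤ) ∙ (λ _ → 0ℤ)
      -- The product of the two rows is itself a function of the class; pairing it with `𝟏` counts
      -- the `ℓ` common blocks with weight `n`.
      ≡⟨ cong₂ _+_ (sym (𝟏∙-* (I p ∘ to ∘ class) (I q ∘ to ∘ class))) (∙-zero (λ _ → 0ℤ)) ⟩
    𝟏 ∙ ((λ i → I p (to i) * I q (to i)) ∘ class) + 0ℤ
      ≡⟨ +-identityʳ _ ⟩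
    𝟏 ∙ ((λ i → I p (to i) * I q (to i)) ∘ class)
      ≡⟨ ∙-class-constant 𝟏 (+ n) 𝟏∙class (λ i → I p (to i) * I q (to i)) ⟩
    + n * ((λ i → I p (to i) * I q (to i)) ∙ 𝟏)
      ≡⟨ cong (+ n *_) (trans (∙-comm _ 𝟏) (𝟏∙-* (I p ∘ to) (I q ∘ to))) ⟩
    + n * ((I p ∘ to) ∙ (I q ∘ to))
      ≡⟨ cong (+ n *_) (trans (∙-permute (I p) (I q) φ) (I∙I-≢ (p≢q ∘ cong inj₂))) ⟩
    + n * + ℓ
      ≡⟨ trans (*-comm (+ n) (+ ℓ)) ℓn≡ ⟩
    + κ * t ∎

  open Graph (Γ Δ 𝒟 φ) using (degree; commonNeighbours)

  Γ-degree : ∀ x → + degree x ≡ + κ * + n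
  Γ-degree x = trans (∣tabulate∣ (λ y → does (adjacent? Δ 𝒟 φ (splitAt V x) (splitAt V y)))) (degree-Γ (splitAt V x))

  Γ-commonNeighbours : ∀ x y → x ≢ y → + commonNeighbours x y ≡ + κ * t
  Γ-commonNeighbours x y x≢y = trans
    (∣tabulate∩tabulate∣ (λ z → does (adjacent? Δ 𝒟 φ (splitAt V x) (splitAt V z)))
                         (λ z → does (adjacent? Δ 𝒟 φ (splitAt V y) (splitAt V z))))
    (commonNeighbours-Γ (splitAt V x) (splitAt V y) (x≢y ∘ splitAt-injective))
    where
    splitAt-injective : splitAt V x ≡ splitAt V y → x ≡ y
    splitAt-injective eq = trans (sym (join-splitAt V m x)) (trans (cong (join V m) eq) (join-splitAt V m y))

-- Arithmetic of the parameters.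

-- Here a = -s and t = n + s.
module Parameters {n : ℕ} {a t : ℤ} (m V K λ₁ λ₂ ℓ : ℕ)
                  (0<a : 0ℤ < a) (0<t : 0ℤ < t) (n≡a+t : + n ≡ a + t)
                  (mt≡ : + m * t ≡ a * (+ n - 1ℤ)) (Vt≡ : + V * t ≡ + n * a * (+ n - 1ℤ))
                  (K≡ : + K ≡ a * (+ n - 1ℤ)) (λ₁≡ : + λ₁ ≡ a * (t - 1ℤ))
                  (λ₂n≡ : + λ₂ * + n ≡ a * (+ n - 1ℤ) * t) (ℓn≡ : + ℓ * + n ≡ a * t) where

  instance
    t-nonZero : NonZero t
    t-nonZero = >-nonZero 0<t

    n-nonZero : NonZero (+ n)
    n-nonZero = subst NonZero (sym n≡a+t) (>-nonZero (+-mono-< 0<a 0<t))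

  K≡mt : + K ≡ + m * t
  K≡mt = trans K≡ (sym mt≡)

  -- The zero-variance condition of `classDegree-constant`: the second summand is t - 1 further
  -- copies of `K`.
  K+λ₁[n-1]≡ : + K + + λ₁ * (+ n - 1ℤ) ≡ + m * t * t
  K+λ₁[n-1]≡ = begin
    + K + + λ₁ * (+ n - 1ℤ)                           ≡⟨ cong₂ (λ x y → x + y * (+ n - 1ℤ)) K≡ λ₁≡ ⟩
    a * (+ n - 1ℤ) + a * (t - 1ℤ) * (+ n - 1ℤ)        ≡⟨ collect a (+ n) t ⟩
    a * (+ n - 1ℤ) * t                                ≡⟨ cong (_* t) mt≡ ⟨
    + m * t * t                                       ∎
    where
    collect : ∀ a n t → a * (n - 1ℤ) + a * (t - 1ℤ) * (n - 1ℤ) ≡ a * (n - 1ℤ) * t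
    collect = solve-∀

  λ₁+a≡ : + λ₁ + a ≡ a * t
  λ₁+a≡ = trans (cong (_+ a) λ₁≡) (collect a t)
    where
    collect : ∀ a t → a * (t - 1ℤ) + a ≡ a * t
    collect = solve-∀

  -- Both summands are known only through their products with `n`, so the identity is checked after
  -- multiplying by `n`.
  λ₂+ℓ≡ : + λ₂ + + ℓ ≡ a * t
  λ₂+ℓ≡ = *-cancelʳ-≡ _ _ (+ n) (begin
    (+ λ₂ + + ℓ) * + n                ≡⟨ *-distribʳ-+ (+ n) (+ λ₂) (+ ℓ) ⟩
    + λ₂ * + n + + ℓ * + n            ≡⟨ cong₂ _+_ λ₂n≡ ℓn≡ ⟩
    a * (+ n - 1ℤ) * t + a * t        ≡⟨ collect a (+ n) t ⟩
    a * t * + n                       ∎)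
    where
    collect : ∀ a n t → a * (n - 1ℤ) * t + a * t ≡ a * t * n
    collect = solve-∀

  K+a≡ : + K + a ≡ a * + n
  K+a≡ = trans (cong (_+ a) K≡) (collect a (+ n))
    where
    collect : ∀ a n → a * (n - 1ℤ) + a ≡ a * n
    collect = solve-∀

  -- Multiplying by t n clears both denominators. The key identity is a (n - 1) - t = a n - (a + t)
  -- = (a - 1) n.
  count : + ℓ * (+ m - 1ℤ) ≡ a * (a - 1ℤ)
  count = *-cancelʳ-≡ _ _ t (*-cancelʳ-≡ _ _ (+ n) (begin
    + ℓ * (+ m - 1ℤ) * t * + n              ≡⟨ regroup (+ ℓ) (+ m) t (+ n) ⟩
    + ℓ * + n * (+ m * t - t)               ≡⟨ cong₂ (λ x y → x * (y - t)) ℓn≡ mt≡ ⟩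
    a * t * (a * (+ n - 1ℤ) - t)            ≡⟨ collect a (+ n) t ⟩
    a * t * (a * + n - (a + t))             ≡⟨ cong (λ x → a * t * (a * + n - x)) n≡a+t ⟨
    a * t * (a * + n - + n)                 ≡⟨ collect₂ a (+ n) t ⟩
    a * (a - 1ℤ) * t * + n                  ∎))
    where
    regroup : ∀ l m t n → l * (m - 1ℤ) * t * n ≡ l * n * (m * t - t)
    regroup = solve-∀
    collect : ∀ a n t → a * t * (a * (n - 1ℤ) - t) ≡ a * t * (a * n - (a + t))
    collect = solve-∀
    collect₂ : ∀ a n t → a * t * (a * n - n) ≡ a * (a - 1ℤ) * t * n
    collect₂ = solve-∀

  V+m≡ : V ℕ.+ m ≡ m ℕ.* (n ℕ.+ 1)
  V+m≡ = +-injective (begin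
    + (V ℕ.+ m)                 ≡⟨ pos-+ V m ⟩
    + V + + m                   ≡⟨ cong (_+ + m) V≡nm ⟩
    + n * + m + + m             ≡⟨ collect (+ n) (+ m) ⟩
    + m * (+ n + 1ℤ)            ≡⟨ cong (+ m *_) (pos-+ n 1) ⟨
    + m * + (n ℕ.+ 1)           ≡⟨ pos-* m (n ℕ.+ 1) ⟨
    + (m ℕ.* (n ℕ.+ 1))         ∎)
    where
    collect : ∀ n m → n * m + m ≡ m * (n + 1ℤ)
    collect = solve-∀
    V≡nm : + V ≡ + n * + m
    V≡nm = *-cancelʳ-≡ _ _ t (begin
      + V * t                    ≡⟨ Vt≡ ⟩
      + n * a * (+ n - 1ℤ)       ≡⟨ *-assoc (+ n) a (+ n - 1ℤ) ⟩
      + n * (a * (+ n - 1ℤ))     ≡⟨ cong (+ n *_) mt≡ ⟨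
      + n * (+ m * t)            ≡⟨ *-assoc (+ n) (+ m) t ⟨
      + n * + m * t              ∎)

  -- (λ₂ - λ₁) n = a (n - t) = a², which is nonzero because a is positive.
  λ₁≢λ₂ : + λ₁ - + λ₂ ≢ 0ℤ
  λ₁≢λ₂ eq = <⇒≢ 0<a (sym (Sum.reduce (i*j≡0⇒i≡0∨j≡0 a a²≡0)))
    where
    collect : ∀ a n t → a * (n - 1ℤ) * t - a * (t - 1ℤ) * n ≡ a * (n - t)
    collect = solve-∀
    cancel : ∀ a t → a ≡ a + t - t
    cancel = solve-∀
    expand : ∀ x y n → y * n - x * n ≡ - (x - y) * n
    expand = solve-∀
    a²≡0 : a * a ≡ 0ℤ
    a²≡0 = begin
      a * a                                     ≡⟨ cong (a *_) (cancel a t) ⟩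
      a * (a + t - t)                           ≡⟨ cong (λ x → a * (x - t)) n≡a+t ⟨
      a * (+ n - t)                             ≡⟨ collect a (+ n) t ⟨
      a * (+ n - 1ℤ) * t - a * (t - 1ℤ) * + n   ≡⟨ cong₂ (λ x y → x - y * + n) λ₂n≡ λ₁≡ ⟨
      + λ₂ * + n - + λ₁ * + n                   ≡⟨ expand (+ λ₁) (+ λ₂) (+ n) ⟩
      - (+ λ₁ - + λ₂) * + n                     ≡⟨ cong (λ x → - x * + n) eq ⟩
      0ℤ                                        ∎

  -- If a = 1 then ℓ n = t = n - 1 with t > 0, impossible in ℕ.
  a≢1 : a - 1ℤ ≢ 0ℤ
  a≢1 eq = no-multiple ℓ (begin
    + ℓ * + n        ≡⟨ ℓn≡ ⟩
    a * t            ≡⟨ cong (_* t) a≡1 ⟩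
    1ℤ * t           ≡⟨ *-identityˡ t ⟩
    t                ∎)
    where
    a≡1 : a ≡ 1ℤ
    a≡1 = i-j≡0⇒i≡j a 1ℤ eq
    no-multiple : ∀ l → + l * + n ≢ t
    no-multiple zero    0≡t = <⇒≢ 0<t 0≡t
    -- From (l + 1) n = t = n - 1 it would follow that 1 + l n = 0.
    no-multiple (suc l) l+1*n≡t = contradiction (begin
      + suc (l ℕ.* n)                          ≡⟨ pos-+ 1 (l ℕ.* n) ⟩
      1ℤ + + (l ℕ.* n)                         ≡⟨ cong (λ x → 1ℤ + x) (pos-* l n) ⟩
      1ℤ + + l * + n                           ≡⟨ collect (+ l) (+ n) t ⟩
      (1ℤ + + l) * + n + (1ℤ + t) - t - + n    ≡⟨ cong₂ (λ x y → x + (1ℤ + t) - t - y) l+1*n≡t n≡1+t ⟩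
      t + (1ℤ + t) - t - (1ℤ + t)              ≡⟨ cancel t ⟩
      0ℤ                                       ∎) λ ()
      where
      n≡1+t : + n ≡ 1ℤ + t
      n≡1+t = trans n≡a+t (cong (_+ t) a≡1)
      collect : ∀ l n t → 1ℤ + l * n ≡ (1ℤ + l) * n + (1ℤ + t) - t - n
      collect = solve-∀
      cancel : ∀ t → t + (1ℤ + t) - t - (1ℤ + t) ≡ 0ℤ
      cancel = solve-∀

-- Strong regularity of `Γ`.

Γ-isStronglyRegular :
  ∀ {n κ : ℕ} {a t : ℤ} (m V K λ₁ λ₂ ℓ : ℕ) → 0ℤ < a → 0ℤ < t → + n ≡ a + t →
  + m * t ≡ a * (+ n - 1ℤ) → + V * t ≡ + n * a * (+ n - 1ℤ) →
  + K ≡ a * (+ n - 1ℤ) → + λ₁ ≡ a * (t - 1ℤ) →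
  + λ₂ * + n ≡ a * (+ n - 1ℤ) * t → + κ ≡ a → + ℓ * + n ≡ a * t →
  (Δ : DivisibleDesignGraph V K λ₁ λ₂ m n) (𝒟 : SymmetricDesign m κ ℓ) (φ : Fin m ⤖ Fin m) →
  ∃₂ λ k μ → + k ≡ a * + n × + μ ≡ a * t × IsStronglyRegular (Γ Δ 𝒟 φ) (m ℕ.* (n ℕ.+ 1)) k μ μ
-- Since `a` is a variable here, matching `+ κ ≡ a` with `refl` replaces it by `+ κ`; the expression
-- `- s` would not allow this.
Γ-isStronglyRegular {n} {κ} {t = t} m V K λ₁ λ₂ ℓ 0<a 0<t n≡a+t mt≡ Vt≡ K≡ λ₁≡ λ₂n≡ refl ℓn≡ Δ 𝒟 φ =
  -- The product ℓ n is a natural number equal to a t, so it can serve as μ although `t` is an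
  -- integer.
  κ ℕ.* n , ℓ ℕ.* n , pos-* κ n , μ≡ , record
    { order       = V+m≡
    ; regular     = λ x → +-injective (trans (E.Γ-degree x) (sym (pos-* κ n)))
    ; adjacent    = λ x y x~y → commonNeighbours≡μ x y λ x≡y → Graph.~-irrefl (Γ Δ 𝒟 φ) {x} {y} x≡y x~y
    ; nonadjacent = λ x y x≢y _ → commonNeighbours≡μ x y x≢y
    }
  where
  open Parameters m V K λ₁ λ₂ ℓ 0<a 0<t n≡a+t mt≡ Vt≡ K≡ λ₁≡ λ₂n≡ ℓn≡
  module E = Extension Δ 𝒟 φ t count {{≢-nonZero a≢1}} {{≢-nonZero λ₁≢λ₂}} K≡mt K+λ₁[n-1]≡ ℓn≡ λ₁+a≡ λ₂+ℓ≡ K+a≡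
  μ≡ : + (ℓ ℕ.* n) ≡ + κ * t
  μ≡ = trans (pos-* ℓ n) ℓn≡
  commonNeighbours≡μ : ∀ x y → x ≢ y → Graph.commonNeighbours (Γ Δ 𝒟 φ) x y ≡ ℓ ℕ.* n
  commonNeighbours≡μ x y x≢y = +-injective (trans (E.Γ-commonNeighbours x y x≢y) (sym μ≡))

theorem4p3 : ∀ (n : ℕ) (s : ℤ) → s < 0ℤ → 0ℤ < + n + s →
    ∀ (m V K λ₁ λ₂ κ ℓ : ℕ) →
    + m * (+ n + s) ≡ - s * (+ n - 1ℤ) →
    + V * (+ n + s) ≡ + n * - s * (+ n - 1ℤ) →
    + K ≡ - s * (+ n - 1ℤ) →
    + λ₁ ≡ - s * (+ n + s - 1ℤ) →
    + λ₂ * + n ≡ - s * (+ n - 1ℤ) * (+ n + s) →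
    + κ ≡ - s →
    + ℓ * + n ≡ - s * (+ n + s) →
    (Δ : DivisibleDesignGraph V K λ₁ λ₂ m n) (𝒟 : SymmetricDesign m κ ℓ) (φ : Fin m ⤖ Fin m) →
    ∃₂ λ k μ → + k ≡ - s * + n × + μ ≡ - s * (+ n + s) ×
    IsStronglyRegular (Γ Δ 𝒟 φ) (m ℕ.* (n ℕ.+ 1)) k μ μ
theorem4p3 n s s<0 0<n+s m V K λ₁ λ₂ κ ℓ =
  -- Instantiates `a` to `- s` and `t` to `+ n + s`.
  Γ-isStronglyRegular m V K λ₁ λ₂ ℓ (neg-mono-< s<0) 0<n+s (split (+ n) s)
  where
  split : ∀ n s → n ≡ - s + (n + s)
  split = solve-∀
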